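{- Let $\phi(x) = x^d + c$, where $c,d \in \mathbb{Z}$ and $d \geq 2$. Let $D_{d,c} = \{n \in \mathbb{Z} : n \ge 1,\ n \mid \phi^n(0)\}$ and let $P_{d,c}$ be the set of primes in $D_{d,c}$. Then the following hold. (1) $2 \in P_{d,c}$. (2) Every positive divisor of $c$ is an element of $D_{d,c}$. In particular, if $p$ is prime and $p \mid c$, then $p \in P_{d,c}$. (3) If $p$ is prime and $d \equiv 1 \pmod{p-1}$, then $p \in P_{d,c}$.
   Context: Here $\phi^n$ denotes the $n$-th iterate of $\phi$. -}

module Defs where

open import Data.Integer.Base using (ℤ; +_; 0ℤ; _+_; _-_; _^_)
open import Data.Integer.Divisibility.Signed using (_∣_)
open import Data.Nat.Base as ℕ using (ℕ)
open import Data.Nat.Primality using (Prime)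
open import Data.Product.Base using (_×_)
open import Function.Endo.Propositional ℤ using () renaming (_^_ to _^∘_)
open import Level using (0ℓ)
open import Relation.Unary using (Pred; _∩_)

infix 4 _≡_[mod_]

_≡_[mod_] : ℤ → ℤ → ℤ → Set
a ≡ b [mod m ] = m ∣ a - b

φ : ℕ → ℤ → ℤ → ℤ
φ d c x = x ^ d + c

-- The positive integers n are represented as n : ℕ with 1 ≤ n, and _^∘_ is
-- iterated composition, so φ d c ^∘ n is the n-th iterate of φ d c.
D : ℕ → ℤ → Pred ℕ 0ℓ
D d c n = 1 ℕ.≤ n × + n ∣ (φ d c ^∘ n) 0ℤ

P : ℕ → ℤ → Pred ℕ 0ℓ
P d c = D d c ∩ Prime

{-# OPTIONS --safe #-}

-- By Fermat's little theorem, d ≡ 1 (mod p - 1) makes x ↦ x ^ d the identity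
-- modulo p, so φ is translation by c and φⁿ(0) ≡ n c (mod p), which vanishes
-- at n = p; part (1) is the case p = 2.  If n divides c then n divides 0 and φ
-- preserves divisibility by n.

module Submission where

open import Data.Integer.Base using (ℤ; +_; -[1+_]; 0ℤ; 1ℤ; _+_; _-_; _*_; -_; _^_)
open import Data.Integer.Divisibility.Signed
  using (_∣_; divides; ∣-refl; ∣ᵤ⇒∣; ∣⇒∣ᵤ; ∣m∣n⇒∣m+n; ∣m+n∣n⇒∣m; ∣m⇒∣-m; ∣n⇒∣m*n; ∣m⇒∣m*n)
open import Data.Integer.Properties as ℤ using (+-*-commutativeSemiring)
open import Data.Integer.Tactic.RingSolver using (solve-∀)
open import Data.Fin.Base using (zero; suc; toℕ; fromℕ; inject₁)
open import Data.Fin.Properties using (toℕ-fromℕ; toℕ-inject₁; toℕ<n)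
open import Data.Nat.Base as ℕ using (ℕ; zero; suc; _≤_; _<_; s≤s; s<s)
open import Data.Nat.Combinatorics using (_C_; nC1≡n; nCn≡1; nCk+nC[k+1]≡[n+1]C[k+1])
open import Data.Nat.Coprimality using (prime⇒coprime; coprime-divisor)
import Data.Nat.Divisibility as ℕ
import Data.Nat.Properties as ℕ
import Data.Nat.Tactic.RingSolver as ℕ
open import Data.Nat.Primality using (Prime; prime[2]; prime⇒nonZero; ¬prime[0]; ¬prime[1])
open import Data.Product.Base using (_×_; _,_)
open import Data.Vec.Functional using (Vector; init; last; tail)
open import Function.Endo.Propositional ℤ using () renaming (_^_ to _^∘_)
open import Relation.Binary.Bundles using (Setoid)
open import Relation.Binary.PropositionalEquality
  using (_≡_; refl; sym; trans; cong; cong₂; subst; module ≡-Reasoning)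
import Relation.Binary.Reasoning.Setoid as ≈-Reasoning
open import Relation.Nullary using (contradiction)
open import Relation.Unary using (_∈_)
open import Defs

open import Algebra.Properties.CommutativeSemiring.Binomial +-*-commutativeSemiring
  using (binomialTerm) renaming (theorem to binomialTheorem)
open import Algebra.Properties.Semiring.Exp ℤ.+-*-semiring
  using () renaming (_^_ to _^′_)
open import Algebra.Properties.Semiring.Mult ℤ.+-*-semiring
  using () renaming (_×_ to _×′_)
open import Algebra.Properties.Semiring.Sum ℤ.+-*-semiring
  using (sum; sum-init-last)

-- The unfolded _≡_[mod_] does not determine its two sides for unification; a
-- record does.
infix 4 _≈_[_]

record _≈_[_] (a b m : ℤ) : Set where
  constructor mkMod
  field
    m∣a-b : a ≡ b [mod m ]

open _≈_[_]

module _ {m : ℤ} where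

  ≈-reflexive : ∀ {a b} → a ≡ b → a ≈ b [ m ]
  ≈-reflexive a≡b .m∣a-b = subst (m ∣_) (sym (ℤ.i≡j⇒i-j≡0 a≡b)) (divides 0ℤ refl)

  ≈-sym : ∀ {a b} → a ≈ b [ m ] → b ≈ a [ m ]
  ≈-sym {a} {b} (mkMod h) .m∣a-b = subst (m ∣_) (lemma a b) (∣m⇒∣-m h)
    where
    lemma : ∀ a b → - (a - b) ≡ b - a
    lemma = solve-∀

  ≈-trans : ∀ {a b c} → a ≈ b [ m ] → b ≈ c [ m ] → a ≈ c [ m ]
  ≈-trans {a} {b} {c} (mkMod h) (mkMod k) .m∣a-b =
    subst (m ∣_) (lemma a b c) (∣m∣n⇒∣m+n h k)
    where
    lemma : ∀ a b c → (a - b) + (b - c) ≡ a - c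
    lemma = solve-∀

  +-≈-congˡ : ∀ c {a b} → a ≈ b [ m ] → c + a ≈ c + b [ m ]
  +-≈-congˡ c {a} {b} (mkMod h) .m∣a-b = subst (m ∣_) (lemma a b c) h
    where
    lemma : ∀ a b c → a - b ≡ (c + a) - (c + b)
    lemma = solve-∀

  +-≈-congʳ : ∀ c {a b} → a ≈ b [ m ] → a + c ≈ b + c [ m ]
  +-≈-congʳ c {a} {b} (mkMod h) .m∣a-b = subst (m ∣_) (lemma a b c) h
    where
    lemma : ∀ a b c → a - b ≡ (a + c) - (b + c)
    lemma = solve-∀

  *-≈-congˡ : ∀ c {a b} → a ≈ b [ m ] → c * a ≈ c * b [ m ]
  *-≈-congˡ c {a} {b} (mkMod h) .m∣a-b = subst (m ∣_) (lemma a b c) (∣n⇒∣m*n c h)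
    where
    lemma : ∀ a b c → c * (a - b) ≡ c * a - c * b
    lemma = solve-∀

  ≈-∣ : ∀ {a b} → a ≈ b [ m ] → m ∣ b → m ∣ a
  ≈-∣ {a} {b} (mkMod h) m∣b = ∣m+n∣n⇒∣m {n = - b} h (∣m⇒∣-m m∣b)

modSetoid : ℤ → Setoid _ _
modSetoid m = record
  { Carrier = ℤ
  ; _≈_ = _≈_[ m ]
  ; isEquivalence = record { refl = ≈-reflexive refl ; sym = ≈-sym ; trans = ≈-trans }
  }

∣-^ : ∀ {m x} n → 1 ≤ n → m ∣ x → m ∣ x ^ n
∣-^ {x = x} (suc n) _ m∣x = ∣m⇒∣m*n (x ^ n) m∣x

∣-sum : ∀ {m n} (f : Vector ℤ n) → (∀ i → m ∣ f i) → m ∣ sum f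
∣-sum {n = zero}  f m∣f = divides 0ℤ refl
∣-sum {n = suc n} f m∣f = ∣m∣n⇒∣m+n (m∣f zero) (∣-sum (tail f) (λ i → m∣f (suc i)))

-- The binomial theorem is stated with the powers and multiples of an arbitrary semiring. This and
-- `×′≡*` carry its terms over to integer arithmetic.
^′≡^ : ∀ x n → x ^′ n ≡ x ^ n
^′≡^ x zero    = refl
^′≡^ x (suc n) = cong (x *_) (^′≡^ x n)

×′≡* : ∀ n x → n ×′ x ≡ + n * x
×′≡* zero    x = refl
×′≡* (suc n) x = trans (cong (λ y → x + y) (×′≡* n x)) (sym (ℤ.suc-* (+ n) x))

-- Absorption identity, multiplied out so that no division occurs. It follows from Pascal's rule by
-- induction on `n`.
[1+k]*[1+n]C[1+k]≡[1+n]*nCk : ∀ n k →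
  suc k ℕ.* (suc n C suc k) ≡ suc n ℕ.* (n C k)
[1+k]*[1+n]C[1+k]≡[1+n]*nCk n zero =
  trans (ℕ.*-identityˡ _) (trans (nC1≡n (suc n)) (sym (ℕ.*-identityʳ (suc n))))
[1+k]*[1+n]C[1+k]≡[1+n]*nCk zero (suc k) = ℕ.*-zeroʳ (2 ℕ.+ k)
[1+k]*[1+n]C[1+k]≡[1+n]*nCk (suc n) (suc k) = begin
  suc (suc k) ℕ.* (suc (suc n) C suc (suc k))
    ≡⟨ cong (suc (suc k) ℕ.*_) (nCk+nC[k+1]≡[n+1]C[k+1] (suc n) (suc k)) ⟨
  -- Splitting one copy of `a` off leaves `suc k` copies of `a` and `suc (suc k)` of `b`, the left
  -- sides of the induction hypotheses at `k` and `suc k`.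
  suc (suc k) ℕ.* (a ℕ.+ b)
    ≡⟨ distrib k a b ⟩
  a ℕ.+ (suc k ℕ.* a ℕ.+ suc (suc k) ℕ.* b)
    ≡⟨ cong (a ℕ.+_) (cong₂ ℕ._+_ ([1+k]*[1+n]C[1+k]≡[1+n]*nCk n k)
                                  ([1+k]*[1+n]C[1+k]≡[1+n]*nCk n (suc k))) ⟩
  a ℕ.+ (suc n ℕ.* (n C k) ℕ.+ suc n ℕ.* (n C suc k))
    ≡⟨ cong (a ℕ.+_) (ℕ.*-distribˡ-+ (suc n) (n C k) (n C suc k)) ⟨
  a ℕ.+ suc n ℕ.* ((n C k) ℕ.+ (n C suc k))
    ≡⟨ cong (λ z → a ℕ.+ suc n ℕ.* z) (nCk+nC[k+1]≡[n+1]C[k+1] n k) ⟩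
  suc (suc n) ℕ.* a ∎
  where
  open ≡-Reasoning
  a = suc n C suc k
  b = suc n C suc (suc k)
  distrib : ∀ k a b → suc (suc k) ℕ.* (a ℕ.+ b) ≡ a ℕ.+ (suc k ℕ.* a ℕ.+ suc (suc k) ℕ.* b)
  distrib = ℕ.solve-∀

-- By absorption `p` divides `suc k` times the coefficient, and `p` is coprime to `suc k` because
-- `0 < suc k < p`.
prime∣pC[1+k] : ∀ {p k} → Prime p → suc k < p → p ℕ.∣ p C suc k
prime∣pC[1+k] {suc n} {k} pr k<p = coprime-divisor (prime⇒coprime pr k<p)
  (subst (suc n ℕ.∣_) (sym ([1+k]*[1+n]C[1+k]≡[1+n]*nCk n k)) (ℕ.m∣m*n (n C k)))

-- In the binomial expansion only the two outer terms survive modulo `p`: each inner coefficient is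
-- a multiple of `p`.
frobenius-+ : ∀ {p} → Prime p → ∀ x y → (x + y) ^ p ≈ x ^ p + y ^ p [ + p ]
frobenius-+ {zero}      pr = contradiction pr ¬prime[0]
frobenius-+ {p@(suc n)} pr x y .m∣a-b = subst (+ p ∣_) (sym difference) (∣-sum middle p∣middle)
  where
  open ≡-Reasoning
  term   = binomialTerm x y p
  middle = init (tail term)

  -- The exponent of `x` here is `1 + i` with `i < n`, hence strictly between `0` and `p = 1 + n`.
  p∣middle : ∀ i → + p ∣ middle i
  p∣middle i = subst (+ p ∣_) (sym (×′≡* (p C suc (toℕ (inject₁ i))) _))
    (∣m⇒∣m*n {m = + (p C suc (toℕ (inject₁ i)))} _ (∣ᵤ⇒∣ (prime∣pC[1+k] pr
      (s<s (subst (_< n) (sym (toℕ-inject₁ i)) (toℕ<n i))))))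

  -- Term `k` carries `x` to the power `k` and `y` to the power `p - k`, so the expansion starts at
  -- `y ^ p` and ends at `x ^ p`.
  first : term zero ≡ y ^ p
  first = trans (ℤ.+-identityʳ _) (trans (ℤ.*-identityˡ _) (^′≡^ y p))

  final : last (tail term) ≡ x ^ p
  final = begin
    (p C suc (toℕ (fromℕ n))) ×′ (x ^′ suc (toℕ (fromℕ n)) * y ^′ (n ℕ.∸ toℕ (fromℕ n)))
      ≡⟨ cong (λ k → (p C suc k) ×′ (x ^′ suc k * y ^′ (n ℕ.∸ k))) (toℕ-fromℕ n) ⟩
    (p C p) ×′ (x ^′ p * y ^′ (n ℕ.∸ n))
      ≡⟨ cong₂ (λ c k → c ×′ (x ^′ p * y ^′ k)) (nCn≡1 p) (ℕ.n∸n≡0 n) ⟩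
    x ^′ p * 1ℤ + 0ℤ  ≡⟨ ℤ.+-identityʳ _ ⟩
    x ^′ p * 1ℤ       ≡⟨ ℤ.*-identityʳ _ ⟩
    x ^′ p            ≡⟨ ^′≡^ x p ⟩
    x ^ p             ∎

  cancel : ∀ a b s → a + (s + b) - (b + a) ≡ s
  cancel = solve-∀

  difference : (x + y) ^ p - (x ^ p + y ^ p) ≡ sum middle
  difference = begin
    (x + y) ^ p - (x ^ p + y ^ p)
      ≡⟨ cong (_- (x ^ p + y ^ p)) (trans (sym (^′≡^ (x + y) p)) (binomialTheorem p x y)) ⟩
    term zero + sum (tail term) - (x ^ p + y ^ p)
      ≡⟨ cong (λ z → term zero + z - (x ^ p + y ^ p)) (sum-init-last (tail term)) ⟩
    term zero + (sum middle + last (tail term)) - (x ^ p + y ^ p)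
      ≡⟨ cong₂ (λ a b → a + (sum middle + b) - (x ^ p + y ^ p)) first final ⟩
    y ^ p + (sum middle + x ^ p) - (x ^ p + y ^ p)
      ≡⟨ cancel (y ^ p) (x ^ p) (sum middle) ⟩
    sum middle ∎

0^prime≡0 : ∀ {p} → Prime p → 0ℤ ^ p ≡ 0ℤ
0^prime≡0 {zero}  pr = contradiction pr ¬prime[0]
0^prime≡0 {suc _} pr = refl

fermat-+ : ∀ {p} → Prime p → ∀ n → (+ n) ^ p ≈ + n [ + p ]
fermat-+ pr zero = ≈-reflexive (0^prime≡0 pr)
fermat-+ {p} pr (suc n) = begin
  (1ℤ + + n) ^ p      ≈⟨ frobenius-+ pr 1ℤ (+ n) ⟩
  1ℤ ^ p + (+ n) ^ p  ≡⟨ cong (_+ (+ n) ^ p) (ℤ.^-zeroˡ p) ⟩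
  1ℤ + (+ n) ^ p      ≈⟨ +-≈-congˡ 1ℤ (fermat-+ pr n) ⟩
  1ℤ + + n            ∎
  where open ≈-Reasoning (modSetoid (+ p))

-- The negative case avoids a parity split on `p`: for `x + y = 0`, additivity gives
-- `x ^ p + y ^ p ≈ 0`, and `y ^ p ≈ y` is the natural case.
fermat : ∀ {p} → Prime p → ∀ x → x ^ p ≈ x [ + p ]
fermat     pr (+ n) = fermat-+ pr n
-- Here x = - y, so x ^ p - x is definitionally x ^ p + y.
fermat {p} pr x@(-[1+ n ]) .m∣a-b = ≈-∣ (begin
  x ^ p + y      ≈⟨ +-≈-congˡ (x ^ p) (fermat-+ pr (suc n)) ⟨
  x ^ p + y ^ p  ≈⟨ frobenius-+ pr x y ⟨
  (x + y) ^ p    ≡⟨ cong (_^ p) (ℤ.+-inverseˡ y) ⟩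
  0ℤ ^ p         ≡⟨ 0^prime≡0 pr ⟩
  0ℤ             ∎) (divides 0ℤ refl)
  where
  open ≈-Reasoning (modSetoid (+ p))
  y = + suc n

-- Each further block of `n = p - 1` factors is absorbed by one use of Fermat in the form
-- `x ^ p ≈ x`, which also covers multiples of `p`.
x^[1+k[p-1]]≈x : ∀ {n} → Prime (suc n) → ∀ k x →
  x ^ suc (k ℕ.* n) ≈ x [ + suc n ]
x^[1+k[p-1]]≈x     pr zero    x = ≈-reflexive (ℤ.^-identityʳ x)
x^[1+k[p-1]]≈x {n} pr (suc k) x = begin
  x * x ^ (n ℕ.+ k ℕ.* n)      ≡⟨ cong (x *_) (ℤ.^-distribˡ-+-* x n (k ℕ.* n)) ⟩
  x * (x ^ n * x ^ (k ℕ.* n))  ≡⟨ swap x (x ^ n) _ ⟩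
  x ^ n * x ^ suc (k ℕ.* n)    ≈⟨ *-≈-congˡ (x ^ n) (x^[1+k[p-1]]≈x pr k x) ⟩
  x ^ n * x                    ≡⟨ ℤ.*-comm (x ^ n) x ⟩
  x ^ suc n                    ≈⟨ fermat pr x ⟩
  x                            ∎
  where
  open ≈-Reasoning (modSetoid (+ suc n))
  swap : ∀ a b c → a * (b * c) ≡ b * (a * c)
  swap = solve-∀

d≡1⇒x^d≈x : ∀ {p d} → Prime p → 2 ≤ d → + d ≡ 1ℤ [mod + p - 1ℤ ] →
  ∀ x → x ^ d ≈ x [ + p ]
d≡1⇒x^d≈x {zero}        pr _ _ = contradiction pr ¬prime[0]
d≡1⇒x^d≈x {suc zero}    pr _ _ = contradiction pr ¬prime[1]
-- With the successors exposed, `+ d - 1ℤ` and `+ p - 1ℤ` compute to naturals, so `h` yields a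
-- natural `k` with `d - 1 = k * (p - 1)`.
d≡1⇒x^d≈x {p@(suc (suc _))} {suc (suc _)} pr (s≤s (s≤s _)) h x with ∣⇒∣ᵤ h
... | ℕ.divides k d-1≡k[p-1] =
  subst (λ e → x ^ suc e ≈ x [ + p ]) (sym d-1≡k[p-1]) (x^[1+k[p-1]]≈x pr k x)

φⁿ0≈nc : ∀ {m} d c → (∀ x → x ^ d ≈ x [ m ]) →
  ∀ n → (φ d c ^∘ n) 0ℤ ≈ + n * c [ m ]
φⁿ0≈nc     d c h zero    = ≈-reflexive refl
φⁿ0≈nc {m} d c h (suc n) = begin
  x ^ d + c    ≈⟨ +-≈-congʳ c (h x) ⟩
  x + c        ≈⟨ +-≈-congʳ c (φⁿ0≈nc d c h n) ⟩
  + n * c + c  ≡⟨ ℤ.+-comm (+ n * c) c ⟩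
  c + + n * c  ≡⟨ ℤ.suc-* (+ n) c ⟨
  + suc n * c  ∎
  where
  open ≈-Reasoning (modSetoid m)
  x = (φ d c ^∘ n) 0ℤ

-- The orbit starts at the multiple `0ℤ`. The bound `1 ≤ d` keeps the power a multiple of `m`,
-- whereas `x ^ 0` would be `1ℤ`.
∣c⇒∣φⁿ0 : ∀ {m} d c → 1 ≤ d → m ∣ c → ∀ n → m ∣ (φ d c ^∘ n) 0ℤ
∣c⇒∣φⁿ0 d c 1≤d m∣c zero    = divides 0ℤ refl
∣c⇒∣φⁿ0 d c 1≤d m∣c (suc n) = ∣m∣n⇒∣m+n (∣-^ d 1≤d (∣c⇒∣φⁿ0 d c 1≤d m∣c n)) m∣c

prime⇒1≤ : ∀ {p} → Prime p → 1 ≤ p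
prime⇒1≤ {p} pr = ℕ.>-nonZero⁻¹ p {{prime⇒nonZero pr}}

theorem1p5 : (d : ℕ) (c : ℤ) → 2 ≤ d →
    (2 ∈ P d c)
    × ((∀ (n : ℕ) → 1 ≤ n → + n ∣ c → n ∈ D d c)
       × (∀ (p : ℕ) → Prime p → + p ∣ c → p ∈ P d c))
    × (∀ (p : ℕ) → Prime p → + d ≡ 1ℤ [mod + p - 1ℤ ] → p ∈ P d c)
theorem1p5 d c 2≤d =
  -- For `p = 2` the modulus `p - 1` is `1`, so the congruence on `d` always holds.
  part3 2 prime[2] (∣ᵤ⇒∣ (ℕ.1∣ _)) ,
  (part2 , λ p pr p∣c → part2 p (prime⇒1≤ pr) p∣c , pr) ,
  part3
  where
  part2 : ∀ n → 1 ≤ n → + n ∣ c → n ∈ D d c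
  -- Here `n` is both the modulus and the number of iterations.
  part2 n 1≤n n∣c = 1≤n , ∣c⇒∣φⁿ0 d c (ℕ.<⇒≤ 2≤d) n∣c n

  part3 : ∀ p → Prime p → + d ≡ 1ℤ [mod + p - 1ℤ ] → p ∈ P d c
  part3 p pr h =
    (prime⇒1≤ pr , ≈-∣ (φⁿ0≈nc d c (d≡1⇒x^d≈x pr 2≤d h) p) (∣m⇒∣m*n c ∣-refl)) , pr
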